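{- Let $k,\ell\ge 0$ be integers, not both zero. Let $P_i$ ($1\le i\le k$) and $Q_j$ ($1\le j\le\ell$) be L-bounded posets with large intervals $I_i$ and $I'_j$, respectively. Further, assume each $P_i$ has a $\hat 0$ and each $Q_j$ has a $\hat 1$. (If $k=0$ or $\ell=0$, the corresponding collection is empty.) Then the poset $$R:=Q_1\oplus_I\cdots\oplus_I Q_\ell\oplus_I P_1\oplus_I\cdots\oplus_I P_k$$ is L-bounded.
   Context: All posets are finite and nonempty. Let $[n]=\{1,\dots,n\}$; families of subsets of $[n]$ are ordered by inclusion. A poset $(P,\le)$ contains a poset $(P',\le')$ as a (weak) subposet if there is an injection $f:P'\to P$ such that $u\le' v$ implies $f(u)\le f(v)$. A family $\mathcal F\subseteq 2^{[n]}$ is $P$-free if it does not contain $P$ in this sense. $e(P)$ is the maximum integer $k\ge 0$ such that for all integers $n$ and $s$ the family $\binom{[n]}{s}\cup\binom{[n]}{s+1}\cup\cdots\cup\binom{[n]}{s+k-1}$ is $P$-free, where $\binom{[n]}{j}$ is the collection of $j$-element subsets of $[n]$ (empty if $j<0$ or $j>n$). The Lubell function of $\mathcal F\subseteq 2^{[n]}$ is the average over all $n!$ full (maximal) chains $\mathcal C$ of $2^{[n]}$ of $|\mathcal F\cap\mathcal C|$; equivalently $\bar h_n(\mathcal F)=\sum_{F\in\mathcal F}1/\binom{n}{|F|}$. For an integer $m\ge0$, $P$ is $m$-L-bounded if for all $n$, $\bar h_n(\mathcal F)\le e(P)$ for every $P$-free family $\mathcal F$ of subsets of $[n]$ all of whose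 members have sizes in $[m,n-m]$. $P$ is L-bounded if it is $m$-L-bounded for some integer $m\ge 0$. An element $x$ of a poset $P$ is $\hat 0$ (resp. $\hat 1$) if $x\le p$ (resp. $x\ge p$) for all $p\in P$. For $a\le b$ in $P$, the interval $[a,b]$ is the subposet $\{c\in P: a\le c\le b\}$. A large interval of $P$ is a maximal (under inclusion) interval $I$ of $P$ with $e(I)=e(P)$. Given posets $S_1,\dots,S_r$ with chosen large intervals $J_1,\dots,J_r$, $S_1\oplus_I S_2\oplus_I\cdots\oplus_I S_r$ denotes the poset obtained from the disjoint union of the $S_i$ by identifying, for $1\le i\le r-1$, the maximal element of $J_i$ with the minimal element of $J_{i+1}$, the order being the transitive closure of the union of the orders of the $S_i$. (An L-bounded poset has at most one large interval, so here the operation does not depend on choices.) -}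

module Defs where

open import Data.Fin.Base using (Fin; toℕ)
open import Data.Fin.Subset using (Subset; ∣_∣; inside; outside)
open import Data.Fin.Subset.Properties using (⊆-poset; ∣p∣≤n)
open import Data.Integer.Base as ℤ using (ℤ; +_)
open import Data.List.Base using (List; []; _∷_; _++_; map; filter; foldr)
import Data.List.Relation.Unary.Enumerates.Setoid as Enumerates
open import Data.Nat.Base using (ℕ; zero; suc; _∸_; _+_; _≤_; _<_; NonZero; >-nonZero; _!)
open import Data.Nat.Combinatorics
  using (_C_; nCk≡n!/k![n-k]!; [n∸k]!k!∣n!)
open import Data.Nat.Divisibility using (∣⇒≤)
open import Data.Nat.DivMod using (m≥n⇒m/n>0)
open import Data.Nat.Properties using (_!≢0; _!*_!≢0; *-comm)
open import Data.Product.Base using (Σ; ∃; ∃-syntax; _×_; _,_; proj₁; proj₂)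
open import Data.Rational.Base as ℚ using (ℚ; 0ℚ; _/_)
open import Data.Vec.Base using (Vec; []; _∷_)
open import Function.Definitions using (Injective)
open import Level using (0ℓ)
open import Relation.Binary.Bundles using (Poset; DecPoset)
open import Relation.Binary.Construct.Closure.ReflexiveTransitive using (Star; ε; _◅◅_)
import Relation.Binary.Construct.Interior.Symmetric as SymInterior
import Relation.Binary.Construct.On as On
open import Relation.Binary.Core using (Rel)
open import Relation.Binary.Definitions using (Minimum; Maximum)
open import Relation.Binary.Morphism.Bundles using (PosetHomomorphism)
open import Relation.Binary.PropositionalEquality.Core using (_≡_; sym; subst)
open import Relation.Nullary.Negation.Core using (¬_)
open import Relation.Unary using (Pred; Decidable)

-- Posets carry their own equality _≈_, so that identifying elements needs no
-- quotient type.

Pos : Set₁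
Pos = Poset 0ℓ 0ℓ 0ℓ

-- Finite means finite up to _≈_.  Decidability of _≈_ and _≤_ is classically
-- automatic.  Nonemptiness is not a field: it will follow from a chosen interval.

record FinPoset : Set₁ where
  field
    decPoset      : DecPoset 0ℓ 0ℓ 0ℓ
  open DecPoset decPoset public using (poset)
  open Enumerates (Poset.Eq.setoid poset) public using (IsEnumeration)
  field
    elements      : List (Poset.Carrier poset)
    isEnumeration : IsEnumeration elements

open FinPoset public using (poset)

-- P′ ⊑ P : the poset P contains P′ as a weak subposet.

infix 4 _⊑_

_⊑_ : Pos → Pos → Set
P′ ⊑ P = Σ (PosetHomomorphism P′ P) λ f →
  Injective (Poset._≈_ P′) (Poset._≈_ P) (PosetHomomorphism.⟦_⟧ f)

Family : ℕ → Set₁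
Family n = Pred (Subset n) 0ℓ

familyPoset : ∀ {n} → Family n → Pos
familyPoset {n} 𝓕 = On.poset (⊆-poset n) (proj₁ {B = 𝓕})

Free : ∀ {n} → Pos → Family n → Set
Free P 𝓕 = ¬ (P ⊑ familyPoset 𝓕)

levels : ∀ n → ℤ → ℕ → Family n
levels n s k A = ∃[ j ] (j < k × + ∣ A ∣ ≡ s ℤ.+ + j)

LevelsFree : Pos → ℕ → Set
LevelsFree P k = ∀ n s → Free P (levels n s k)

-- IsE P k says e(P) = k.  As e is a maximum, k is unique.

IsE : Pos → ℕ → Set
IsE P k = LevelsFree P k × (∀ k′ → LevelsFree P k′ → k′ ≤ k)

subsets : ∀ n → List (Subset n)
subsets zero    = [] ∷ []
subsets (suc n) = map (outside ∷_) (subsets n) ++ map (inside ∷_) (subsets n)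

nCk≢0 : ∀ {n k} → k ≤ n → NonZero (n C k)
nCk≢0 {n} {k} k≤n = >-nonZero
  (subst (0 <_) (sym (nCk≡n!/k![n-k]! k≤n))
    (m≥n⇒m/n>0 (subst (_≤ n !) (*-comm ((n ∸ k) !) (k !)) (∣⇒≤ ([n∸k]!k!∣n! k≤n)))))
  where instance
    _ = n !≢0
    _ = k !* (n ∸ k) !≢0

1/C∣_∣ : ∀ {n} → Subset n → ℚ
1/C∣_∣ {n} A = (+ 1 / (n C ∣ A ∣)) {{nCk≢0 (∣p∣≤n A)}}

-- The Lubell function: a set A lies on n! / C(n,∣A∣) of the n! full chains, so
-- the average of ∣𝓕 ∩ 𝓒∣ over full chains 𝓒 is the sum of 1 / C(n,∣A∣) over A ∈ 𝓕.

lubell : ∀ {n} {𝓕 : Family n} → Decidable 𝓕 → ℚ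
lubell {n} 𝓕? = foldr ℚ._+_ 0ℚ (map 1/C∣_∣ (filter 𝓕? (subsets n)))

-- The last argument bounds ∣ A ∣ by n - m, avoiding truncated subtraction.
-- Decidability of 𝓕 only serves to make the sum meaningful constructively.

_-LBounded_ : ℕ → Pos → Set₁
m -LBounded P = ∃[ e ] (IsE P e ×
  (∀ n (𝓕 : Family n) (𝓕? : Decidable 𝓕) →
   (∀ A → 𝓕 A → m ≤ ∣ A ∣ × ∣ A ∣ + m ≤ n) →
   Free P 𝓕 →
   lubell 𝓕? ℚ.≤ + e / 1))

LBounded : Pos → Set₁
LBounded P = ∃[ m ] (m -LBounded P)

Has-0̂ : Pos → Set
Has-0̂ P = ∃ (Minimum (Poset._≤_ P))

Has-1̂ : Pos → Set
Has-1̂ P = ∃ (Maximum (Poset._≤_ P))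

record Interval (P : Pos) : Set where
  open Poset P using (Carrier) renaming (_≤_ to _≼_)
  field
    min     : Carrier
    max     : Carrier
    min≼max : min ≼ max

  Contains : Carrier → Set
  Contains c = min ≼ c × c ≼ max

  intervalPoset : Pos
  intervalPoset = On.poset P (proj₁ {B = Contains})

SameE : (P P′ : Pos) → Set
SameE P P′ = ∃[ k ] (IsE P k × IsE P′ k)

IsLarge : (P : Pos) → Interval P → Set
IsLarge P I = SameE (intervalPoset I) P ×
  (∀ (J : Interval P) → SameE (intervalPoset J) P →
   (∀ c → Contains I c → Contains J c) → (∀ c → Contains J c → Contains I c))
  where open Interval

module _ {r} (S : Fin r → Σ Pos Interval) where

  private
    S′ : Fin r → Pos
    S′ i = proj₁ (S i)

    J : ∀ i → Interval (S′ i)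
    J i = proj₂ (S i)

  open Interval

  -- One step of the order: a comparison within some S i, or passing (in either
  -- direction) between two elements that are to be identified.

  data Step : Rel (Σ (Fin r) λ i → Poset.Carrier (S′ i)) 0ℓ where
    within : ∀ i {x y} → Poset._≤_ (S′ i) x y → Step (i , x) (i , y)
    up     : ∀ i j → toℕ j ≡ suc (toℕ i) → Step (i , max (J i)) (j , min (J j))
    down   : ∀ i j → toℕ j ≡ suc (toℕ i) → Step (j , min (J j)) (i , max (J i))

  -- The order is the reflexive transitive closure of Step, and two elements are
  -- equal when each is ≤ the other.  Since consecutive summands are glued at a
  -- single point, no cycle is created, so this equality identifies nothing
  -- beyond max (J i) with min (J (i+1)).

  ⊕I : Pos
  ⊕I = SymInterior.poset {R = Star Step} ε _◅◅_

module Submission where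

open import Algebra.Bundles using (CommutativeMonoid)
open import Algebra.Properties.CommutativeSemigroup using (x∙yz≈y∙xz)
open import Data.Bool.Properties using () renaming (_≟_ to _≟ᵇ_)
open import Data.Fin.Base using (Fin; zero; suc; toℕ; fromℕ; fromℕ<; splitAt)
import Data.Fin.Properties as Finₚ
open import Data.Fin.Subset using (Subset; ∣_∣; inside; outside; _⊆_; ⊥)
open import Data.Fin.Subset.Properties
  using (∣p∣≤n; ⊆-refl; ⊆-trans; ⊆-antisym; ⊆-isPartialOrder; p⊆q⇒∣p∣≤∣q∣; drop-∷-⊆)
open import Data.Integer.Base as ℤ using (+_)
import Data.Integer.Properties as ℤₚ
open import Data.Integer.Solver using (module +-*-Solver)
open import Data.List.Base using (List; []; _∷_; map; filter; foldr; length) renaming (_++_ to _++ˡ_)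
open import Data.List.Properties using (filter-++; filter-none; filter-≐; length-++)
open import Data.List.Relation.Unary.All using (universal)
open import Data.Nat.Base using (ℕ; zero; suc; pred; _+_; _∸_; _≤_; _<_; _⊔_; z≤n; s≤s; NonZero)
open import Data.Nat.Combinatorics using (_C_; nCn≡1; nCk≡nC[n∸k]; nCk+nC[k+1]≡[n+1]C[k+1])
open import Data.Nat.Induction using (<-wellFounded)
import Data.Nat.Properties as ℕₚ
open import Data.Product.Base using (Σ; ∃-syntax; _×_; _,_; proj₁; proj₂; uncurry)
open import Data.Rational.Base as ℚ using (ℚ; 0ℚ; 1ℚ; _/_)
import Data.Rational.Properties as ℚₚ
import Data.Rational.Unnormalised.Base as ℚᵘ
import Data.Rational.Unnormalised.Properties as ℚᵘₚ
open import Data.Sum.Base using (_⊎_; inj₁; inj₂)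
import Data.Vec.Base as V
import Data.Vec.Properties as Vₚ
open import Data.Vec.Functional using (_++_)
open import Data.Vec.Functional.Properties using (lookup-++-<; lookup-++-≥)
open import Defs
open import Function.Base using (_∘_; flip; id)
open import Induction.WellFounded using (Acc; acc)
open import Level using (0ℓ)
open import Relation.Binary.Bundles using (Poset)
open import Relation.Binary.Construct.Closure.ReflexiveTransitive using (Star; ε; _◅_; _◅◅_)
import Relation.Binary.Construct.Flip.EqAndOrd as Flip
open import Relation.Binary.Construct.Interior.Symmetric using (lhs≤rhs; _,_)
open import Relation.Binary.Core using (Rel)
open import Relation.Binary.Definitions using (Minimum; Maximum; DecidableEquality)
open import Relation.Binary.Morphism.Bundles using (PosetHomomorphism; mkPosetHomo)
open import Relation.Binary.PropositionalEquality
  using (_≡_; _≢_; refl; sym; trans; cong; cong₂; subst; subst₂; module ≡-Reasoning)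
open import Relation.Binary.Structures using (IsPartialOrder)
open import Relation.Nullary.Decidable.Core using (yes; no; ¬¬-excluded-middle; _×-dec_; ¬?; decidable-stable)
open import Relation.Nullary.Negation.Core using (¬_; contradiction; ¬¬-map)
open import Relation.Unary using (Pred; Decidable)

open Interval
open PosetHomomorphism using (⟦_⟧; mono)

-- Let R be glued from R′ and a poset P with a 0̂ placed on top of the large interval of R′.  By
-- maximality the large interval of P starts at 0̂.  For an R-free family 𝓕 let 𝓤 consist of the
-- A ∈ 𝓕 such that the members of 𝓕 above A contain P.  Then 𝓕 ∖ 𝓤 is P-free.  And 𝓤 is R′-free:
-- given a copy of R′ in 𝓤 whose gluing point is the set A, choose B maximal among the sets of the
-- copy that contain A, take a copy of P above B, and move its 0̂ down to A.  The rest of that copy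
-- lies strictly above B, hence avoids the copy of R′, and together they form R.  So the Lubell
-- bounds add up, and R is built from one summand by adding each P upwards and, dually, each Q
-- downwards.  Finally e(R) is the sum of the e's: each large interval needs e + 1 levels and
-- neighbours share one, while enough middle levels exceed the Lubell bound.

-- The Lubell function

/-homo-+ : ∀ i j d .{{_ : NonZero d}} → i / d ℚ.+ j / d ≡ (i ℤ.+ j) / d
/-homo-+ i j (suc d) = ℚₚ.toℚᵘ-injective (begin
  ℚ.toℚᵘ (i / suc d ℚ.+ j / suc d)
    ≈⟨ ℚₚ.toℚᵘ-homo-+ (i / suc d) (j / suc d) ⟩
  ℚ.toℚᵘ (i / suc d) ℚᵘ.+ ℚ.toℚᵘ (j / suc d)
    ≈⟨ ℚᵘₚ.+-cong (ℚₚ.toℚᵘ-fromℚᵘ (ℚᵘ.mkℚᵘ i d)) (ℚₚ.toℚᵘ-fromℚᵘ (ℚᵘ.mkℚᵘ j d)) ⟩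
  ℚᵘ.mkℚᵘ i d ℚᵘ.+ ℚᵘ.mkℚᵘ j d
    ≈⟨ ℚᵘ.*≡* (solve 3 (λ i j d → (i :* d :+ j :* d) :* d := (i :+ j) :* (d :* d)) refl i j (+ suc d)) ⟩
  ℚᵘ.mkℚᵘ (i ℤ.+ j) d
    ≈⟨ ℚₚ.toℚᵘ-fromℚᵘ (ℚᵘ.mkℚᵘ (i ℤ.+ j) d) ⟨
  ℚ.toℚᵘ ((i ℤ.+ j) / suc d) ∎)
  where
  open +-*-Solver
  open import Relation.Binary.Reasoning.Setoid ℚᵘₚ.≃-setoid

n/n≡1 : ∀ n .{{_ : NonZero n}} → + n / n ≡ 1ℚ
n/n≡1 (suc n) = ℚₚ.fromℚᵘ-cong {ℚᵘ.mkℚᵘ (+ suc n) n} {ℚᵘ.1ℚᵘ} (ℚᵘ.*≡* (ℤₚ.*-comm (+ suc n) (+ 1)))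

0/n≡0 : ∀ n .{{_ : NonZero n}} → + 0 / n ≡ 0ℚ
0/n≡0 (suc n) = ℚₚ.fromℚᵘ-cong {ℚᵘ.mkℚᵘ (+ 0) n} {ℚᵘ.0ℚᵘ} (ℚᵘ.*≡* refl)

/1-cancel-≤ : ∀ {a b} → + a / 1 ℚ.≤ + b / 1 → a ≤ b
/1-cancel-≤ {a} {b} a≤b = ℤₚ.drop‿+≤+ (ℤₚ.*-cancelʳ-≤-pos (+ a) (+ b) (+ 1) (ℚᵘₚ.drop-*≤* (
  ℚᵘₚ.≤-respˡ-≃ (ℚₚ.toℚᵘ-fromℚᵘ (ℚᵘ.mkℚᵘ (+ a) 0))
    (ℚᵘₚ.≤-respʳ-≃ (ℚₚ.toℚᵘ-fromℚᵘ (ℚᵘ.mkℚᵘ (+ b) 0)) (ℚₚ.toℚᵘ-mono-≤ a≤b)))))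

module _ {X : Set} (w : X → ℚ) where

  open CommutativeMonoid ℚₚ.+-0-commutativeMonoid using () renaming (commutativeSemigroup to +-commutativeSemigroup)

  total : List X → ℚ
  total xs = foldr ℚ._+_ 0ℚ (map w xs)

  total-split : {F U V : Pred X 0ℓ} (F? : Decidable F) (U? : Decidable U) (V? : Decidable V) →
    (∀ {x} → F x → U x ⊎ V x) → (∀ {x} → U x → F x) → (∀ {x} → V x → F x) → (∀ {x} → U x → ¬ V x) →
    ∀ xs → total (filter F? xs) ≡ total (filter U? xs) ℚ.+ total (filter V? xs)
  total-split F? U? V? F⊆ U⊆F V⊆F disj = go
    where
    go : ∀ xs → total (filter F? xs) ≡ total (filter U? xs) ℚ.+ total (filter V? xs)
    go []       = refl
    go (x ∷ xs) with F? x | U? x | V? x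
    ... | yes f | yes u | yes v = contradiction v (disj u)
    ... | yes f | yes u | no ¬v = trans (cong (w x ℚ.+_) (go xs)) (sym (ℚₚ.+-assoc (w x) _ _))
    ... | yes f | no ¬u | yes v = begin
      w x ℚ.+ total (filter F? xs)
        ≡⟨ cong (w x ℚ.+_) (go xs) ⟩
      w x ℚ.+ (total (filter U? xs) ℚ.+ total (filter V? xs))
        ≡⟨ x∙yz≈y∙xz +-commutativeSemigroup (w x) (total (filter U? xs)) (total (filter V? xs)) ⟩
      total (filter U? xs) ℚ.+ (w x ℚ.+ total (filter V? xs)) ∎
      where open ≡-Reasoning
    ... | yes f | no ¬u | no ¬v with F⊆ f
    ...   | inj₁ u = contradiction u ¬u
    ...   | inj₂ v = contradiction v ¬v
    go (x ∷ xs) | no ¬f | yes u | _     = contradiction (U⊆F u) ¬f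
    go (x ∷ xs) | no ¬f | no ¬u | yes v = contradiction (V⊆F v) ¬f
    go (x ∷ xs) | no ¬f | no ¬u | no ¬v = go xs

  total-empty : {F : Pred X 0ℓ} (F? : Decidable F) → (∀ x → ¬ F x) → ∀ xs → total (filter F? xs) ≡ 0ℚ
  total-empty F? ∅ xs = cong total (filter-none F? (universal ∅ xs))

  total-uniform : {F : Pred X 0ℓ} (F? : Decidable F) (d : ℕ) .{{_ : NonZero d}} →
    (∀ {x} → F x → w x ≡ + 1 / d) → ∀ xs → total (filter F? xs) ≡ + length (filter F? xs) / d
  total-uniform F? d const []       = sym (0/n≡0 d)
  total-uniform F? d const (x ∷ xs) with F? x
  ... | no _  = total-uniform F? d const xs
  ... | yes f = trans (cong₂ ℚ._+_ (const f) (total-uniform F? d const xs)) (/-homo-+ (+ 1) (+ length (filter F? xs)) d)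

lubell-split : ∀ {n} {F U V : Family n} (F? : Decidable F) (U? : Decidable U) (V? : Decidable V) →
  (∀ {A} → F A → U A ⊎ V A) → (∀ {A} → U A → F A) → (∀ {A} → V A → F A) → (∀ {A} → U A → ¬ V A) →
  lubell F? ≡ lubell U? ℚ.+ lubell V?
lubell-split F? U? V? F⊆ U⊆F V⊆F disj = total-split 1/C∣_∣ F? U? V? F⊆ U⊆F V⊆F disj (subsets _)

lubell-≤-split : ∀ {n} {F U V : Family n} (F? : Decidable F) (U? : Decidable U) (V? : Decidable V) →
  (∀ {A} → F A → U A ⊎ V A) → (∀ {A} → U A → F A) → (∀ {A} → V A → F A) → (∀ {A} → U A → ¬ V A) →
  ∀ {a b} → lubell U? ℚ.≤ + a / 1 → lubell V? ℚ.≤ + b / 1 → lubell F? ℚ.≤ + (a + b) / 1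
lubell-≤-split F? U? V? F⊆ U⊆F V⊆F disj {a} {b} U≤a V≤b = begin
  lubell F?                  ≡⟨ lubell-split F? U? V? F⊆ U⊆F V⊆F disj ⟩
  lubell U? ℚ.+ lubell V?    ≤⟨ ℚₚ.+-mono-≤ U≤a V≤b ⟩
  + a / 1 ℚ.+ + b / 1        ≡⟨ /-homo-+ (+ a) (+ b) 1 ⟩
  + (a + b) / 1              ∎
  where open ℚₚ.≤-Reasoning

length-filter-map : ∀ {X Y : Set} {F : Pred Y 0ℓ} (F? : Decidable F) (f : X → Y) xs →
  length (filter F? (map f xs)) ≡ length (filter (F? ∘ f) xs)
length-filter-map F? f []       = refl
length-filter-map F? f (x ∷ xs) with F? (f x)
... | yes _ = cong suc (length-filter-map F? f xs)
... | no _  = length-filter-map F? f xs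

nC0≡1 : ∀ n → n C 0 ≡ 1
nC0≡1 n = trans (nCk≡nC[n∸k] {0} {n} z≤n) (nCn≡1 n)

level? : ∀ {n} j → Decidable (λ (A : Subset n) → ∣ A ∣ ≡ j)
level? j A = ∣ A ∣ ℕₚ.≟ j

-- Pascal's rule, applied to the split of `subsets (suc n)` according to the first coordinate.
length-level : ∀ n j → length (filter (level? j) (subsets n)) ≡ n C j
length-level zero    zero    = refl
length-level zero    (suc j) = refl
length-level (suc n) j       = begin
  length (filter (level? j) (map (outside V.∷_) (subsets n) ++ˡ map (inside V.∷_) (subsets n)))
    ≡⟨ cong length (filter-++ (level? j) (map (outside V.∷_) (subsets n)) _) ⟩
  length (filter (level? j) (map (outside V.∷_) (subsets n)) ++ˡ filter (level? j) (map (inside V.∷_) (subsets n)))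
    ≡⟨ length-++ (filter (level? j) (map (outside V.∷_) (subsets n))) ⟩
  length (filter (level? j) (map (outside V.∷_) (subsets n))) +
  length (filter (level? j) (map (inside V.∷_) (subsets n)))
    ≡⟨ cong₂ _+_ (length-filter-map (level? j) (outside V.∷_) (subsets n))
                 (length-filter-map (level? j) (inside V.∷_) (subsets n)) ⟩
  length (filter (level? j) (subsets n)) + length (filter (level? j ∘ (inside V.∷_)) (subsets n))
    ≡⟨ pascal j ⟩
  suc n C j ∎
  where
  open ≡-Reasoning
  pascal : ∀ j → length (filter (level? j) (subsets n)) +
    length (filter (level? j ∘ (inside V.∷_)) (subsets n)) ≡ suc n C j
  pascal zero    = begin
    _           ≡⟨ cong₂ _+_ (length-level n 0)
                     (cong length (filter-none (level? 0 ∘ (inside V.∷_)) (universal (λ _ ()) (subsets n)))) ⟩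
    n C 0 + 0   ≡⟨ cong (_+ 0) (nC0≡1 n) ⟩
    1           ≡⟨ nC0≡1 (suc n) ⟨
    suc n C 0   ∎
  pascal (suc j) = begin
    _
      ≡⟨ cong₂ _+_ (length-level n (suc j))
           (cong length (filter-≐ _ (level? j) (ℕₚ.suc-injective , cong suc) (subsets n))) ⟩
    n C suc j + length (filter (level? j) (subsets n))
      ≡⟨ cong (λ l → n C suc j + l) (length-level n j) ⟩
    n C suc j + n C j   ≡⟨ ℕₚ.+-comm (n C suc j) (n C j) ⟩
    n C j + n C suc j   ≡⟨ nCk+nC[k+1]≡[n+1]C[k+1] n j ⟩
    suc n C suc j       ∎

1/C-level : ∀ {n j} (A : Subset n) .{{_ : NonZero (n C j)}} → ∣ A ∣ ≡ j → 1/C∣ A ∣ ≡ + 1 / (n C j)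
1/C-level A refl = refl

-- A level consists of `n C j` sets, each of weight `1 / (n C j)`.
lubell-level : ∀ {n j} → j ≤ n → lubell {n} (level? j) ≡ 1ℚ
lubell-level {n} {j} j≤n = begin
  _
    ≡⟨ total-uniform 1/C∣_∣ (level? j) (n C j) (λ {A} → 1/C-level A) (subsets n) ⟩
  + length (filter (level? j) (subsets n)) / (n C j)          ≡⟨ cong (λ l → + l / (n C j)) (length-level n j) ⟩
  + (n C j) / (n C j)                                                    ≡⟨ n/n≡1 (n C j) ⟩
  1ℚ                                                                     ∎
  where
  open ≡-Reasoning
  instance _ = nCk≢0 j≤n

band : ∀ n → ℕ → ℕ → Family n
band n m k A = m ≤ ∣ A ∣ × ∣ A ∣ < m + k

band? : ∀ n m k → Decidable (band n m k)
band? n m k A = (m ℕₚ.≤? ∣ A ∣) ×-dec (∣ A ∣ ℕₚ.<? m + k)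

-- Induction peels off the top level, which is `m + k` in the case `suc k`; the hypothesis keeps it
-- at most `n`, so that it contributes exactly 1.
lubell-band : ∀ {n} m k → m + k ≤ suc n → lubell (band? n m k) ≡ + k / 1
lubell-band {n} m zero    _      =
  total-empty 1/C∣_∣ (band? n m 0)
    (λ A (m≤A , A<m) → ℕₚ.<⇒≱ A<m (subst (_≤ ∣ A ∣) (sym (ℕₚ.+-identityʳ m)) m≤A)) (subsets n)
lubell-band {n} m (suc k) m+k<n = begin
  lubell (band? n m (suc k))
    ≡⟨ lubell-split (band? n m (suc k)) (level? (m + k)) (band? n m k)
         (λ {A} (m≤A , A<) → split A m≤A (ℕₚ.≤-pred (subst (∣ A ∣ <_) (ℕₚ.+-suc m k) A<)))
         (λ {A} eq → subst (m ≤_) (sym eq) (ℕₚ.m≤m+n m k) , subst₂ _<_ (sym eq) (sym (ℕₚ.+-suc m k)) ℕₚ.≤-refl)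
         (λ {A} (m≤A , A<) → m≤A , ℕₚ.<-≤-trans A< (ℕₚ.+-monoʳ-≤ m (ℕₚ.n≤1+n k)))
         (λ eq (_ , A<) → ℕₚ.<-irrefl eq A<) ⟩
  lubell {n} (level? (m + k)) ℚ.+ lubell (band? n m k)
    ≡⟨ cong₂ ℚ._+_ (lubell-level (ℕₚ.≤-pred m+k≤n)) (lubell-band m k (ℕₚ.≤-trans (ℕₚ.n≤1+n _) m+k≤n)) ⟩
  1ℚ ℚ.+ + k / 1
    ≡⟨ /-homo-+ (+ 1) (+ k) 1 ⟩
  + suc k / 1 ∎
  where
  open ≡-Reasoning
  m+k≤n : suc (m + k) ≤ suc n
  m+k≤n = subst (_≤ suc n) (ℕₚ.+-suc m k) m+k<n
  split : ∀ A → m ≤ ∣ A ∣ → ∣ A ∣ ≤ m + k → ∣ A ∣ ≡ m + k ⊎ band n m k A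
  split A m≤A A≤ with ℕₚ.m≤n⇒m<n∨m≡n A≤
  ... | inj₁ A< = inj₂ (m≤A , A<)
  ... | inj₂ eq = inj₁ eq

-- Posets, intervals and e

⊑-trans : ∀ {P Q R : Pos} → P ⊑ Q → Q ⊑ R → P ⊑ R
⊑-trans {P} {Q} {R} (f , f-inj) (g , g-inj) =
  mkPosetHomo P R (⟦ g ⟧ ∘ ⟦ f ⟧) (mono g ∘ mono f) , f-inj ∘ g-inj

embed : ∀ {n} (P : Pos) (𝓕 : Family n) (f : Poset.Carrier P → Subset n) → (∀ x → 𝓕 (f x)) →
  (∀ {x y} → Poset._≤_ P x y → f x ⊆ f y) → (∀ {x y} → f x ≡ f y → Poset._≈_ P x y) → P ⊑ familyPoset 𝓕
embed P 𝓕 f f∈𝓕 f-mono f-inj = mkPosetHomo P (familyPoset 𝓕) (λ x → f x , f∈𝓕 x) f-mono , f-inj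

familyPoset-mono : ∀ {n} {𝓕 𝓖 : Family n} → (∀ {A} → 𝓕 A → 𝓖 A) → familyPoset 𝓕 ⊑ familyPoset 𝓖
familyPoset-mono {𝓕 = 𝓕} {𝓖} 𝓕⊆𝓖 = embed (familyPoset 𝓕) 𝓖 proj₁ (𝓕⊆𝓖 ∘ proj₂) id id

intervalPoset-⊑ : ∀ {P} (I : Interval P) → intervalPoset I ⊑ P
intervalPoset-⊑ {P} I = mkPosetHomo (intervalPoset I) P proj₁ id , id

intervalPoset-mono : ∀ {P} (I J : Interval P) → (∀ {c} → Contains I c → Contains J c) →
  intervalPoset I ⊑ intervalPoset J
intervalPoset-mono I J I⊆J = mkPosetHomo (intervalPoset I) (intervalPoset J) (λ (c , c∈I) → c , I⊆J c∈I) id , id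

LevelsFree-mono : ∀ {P Q k} → P ⊑ Q → LevelsFree P k → LevelsFree Q k
LevelsFree-mono {P} {Q} P⊑Q free n s Q⊑ = free n s (⊑-trans {P} {Q} P⊑Q Q⊑)

IsE-unique : ∀ {P k k′} → IsE P k → IsE P k′ → k ≡ k′
IsE-unique (free , max) (free′ , max′) = ℕₚ.≤-antisym (max′ _ free) (max _ free′)

-- e is monotone, so an interval between a large one and the whole poset has the same e.
⊇-large : ∀ {P} (I J : Interval P) → SameE (intervalPoset I) P → (∀ {c} → Contains I c → Contains J c) →
  SameE (intervalPoset J) P
⊇-large {P} I J (k , (I-free , _) , (P-free , P-max)) I⊆J =
  k , (LevelsFree-mono {intervalPoset I} {intervalPoset J} (intervalPoset-mono I J I⊆J) I-free ,
       λ k′ → P-max k′ ∘ LevelsFree-mono {intervalPoset J} {P} (intervalPoset-⊑ J)) , (P-free , P-max)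

-- Lowering the bottom of `I` to `0̂` gives an interval with the same e, so by maximality `0̂`
-- already lies in `I`, which puts `min I` below it.
min-minimum : ∀ {P} {I : Interval P} → IsLarge P I → Has-0̂ P → Minimum (Poset._≤_ P) (min I)
min-minimum {P} {I} (same , maximal) (0̂ , 0̂≤) x =
  P.trans (proj₁ (maximal J (⊇-large I J same I⊆J) (λ _ → I⊆J) 0̂ (P.refl , 0̂≤ (max I)))) (0̂≤ x)
  where
  module P = Poset P
  J : Interval P
  J = record { min = 0̂ ; max = max I ; min≼max = 0̂≤ (max I) }
  I⊆J : ∀ {c} → Contains I c → Contains J c
  I⊆J (_ , c≤) = 0̂≤ _ , c≤

max-maximum : ∀ {P} {I : Interval P} → IsLarge P I → Has-1̂ P → Maximum (Poset._≤_ P) (max I)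
max-maximum {P} {I} (same , maximal) (1̂ , ≤1̂) x =
  P.trans (≤1̂ x) (proj₂ (maximal J (⊇-large I J same I⊆J) (λ _ → I⊆J) 1̂ (≤1̂ (min I) , P.refl)))
  where
  module P = Poset P
  J : Interval P
  J = record { min = min I ; max = 1̂ ; min≼max = ≤1̂ (min I) }
  I⊆J : ∀ {c} → Contains I c → Contains J c
  I⊆J (≤c , _) = ≤c , ≤1̂ _

large-LevelsFree : ∀ {P e} (I : Interval P) → IsE P e → IsLarge P I → LevelsFree (intervalPoset I) e
large-LevelsFree {P} I isE ((k , (free , _) , isE′) , _) =
  subst (LevelsFree (intervalPoset I)) (IsE-unique {P} isE′ isE) free

-- If the gap were smaller, the copy of the interval would fit into the `e` consecutive levels
-- starting at the size of `f (min I)`.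
interval-gap : ∀ {P e n} (I : Interval P) → LevelsFree (intervalPoset I) e →
  (f : Poset.Carrier P → Subset n) → (∀ {x y} → Poset._≤_ P x y → f x ⊆ f y) →
  (∀ {x y} → f x ≡ f y → Poset._≈_ P x y) → ∣ f (min I) ∣ + e ≤ ∣ f (max I) ∣
interval-gap {P} {e} {n} I free f f-mono f-inj = ℕₚ.≮⇒≥ λ short →
  free n (+ a) (embed (intervalPoset I) (levels n (+ a) e) (f ∘ proj₁) (level short) f-mono f-inj)
  where
  a = ∣ f (min I) ∣
  level : ∣ f (max I) ∣ < a + e → ∀ ((x , _) : Σ (Poset.Carrier P) (Contains I)) → levels n (+ a) e (f x)
  level short (x , min≤x , x≤max) = ∣ f x ∣ ∸ a ,
    ℕₚ.+-cancelˡ-< a _ _ (subst (_< a + e) (sym eq) (ℕₚ.≤-<-trans (p⊆q⇒∣p∣≤∣q∣ (f-mono x≤max)) short)) ,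
    cong +_ (sym eq)
    where
    eq : a + (∣ f x ∣ ∸ a) ≡ ∣ f x ∣
    eq = ℕₚ.m+[n∸m]≡n (p⊆q⇒∣p∣≤∣q∣ (f-mono min≤x))

-- Maximal elements and moving a bottom down

⊆-∣∣-≡ : ∀ {n} {A B : Subset n} → A ⊆ B → ∣ B ∣ ≤ ∣ A ∣ → A ≡ B
⊆-∣∣-≡ {A = V.[]} {V.[]} A⊆B B≤A = refl
⊆-∣∣-≡ {A = outside V.∷ A} {outside V.∷ B} A⊆B B≤A = cong (outside V.∷_) (⊆-∣∣-≡ (drop-∷-⊆ A⊆B) B≤A)
⊆-∣∣-≡ {A = inside V.∷ A} {inside V.∷ B} A⊆B B≤A = cong (inside V.∷_) (⊆-∣∣-≡ (drop-∷-⊆ A⊆B) (ℕₚ.≤-pred B≤A))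
⊆-∣∣-≡ {A = inside V.∷ A} {outside V.∷ B} A⊆B B≤A with () ← A⊆B V.here
⊆-∣∣-≡ {A = outside V.∷ A} {inside V.∷ B} A⊆B B≤A = contradiction (p⊆q⇒∣p∣≤∣q∣ (drop-∷-⊆ A⊆B)) (ℕₚ.<⇒≱ B≤A)

-- `asc` serves for attaching a summand upwards at its bottom, `desc` for attaching one downwards at
-- its top; `orient` makes both one argument.
data Dir : Set where
  asc desc : Dir

orient : Dir → ∀ {a ℓ} {A : Set a} → Rel A ℓ → Rel A ℓ
orient asc  R = R
orient desc R = flip R

_≟ˢ_ : ∀ {n} → DecidableEquality (Subset n)
_≟ˢ_ = Vₚ.≡-dec _≟ᵇ_

orient-⊆-isPartialOrder : ∀ dir {n} → IsPartialOrder _≡_ (orient dir (_⊆_ {n}))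
orient-⊆-isPartialOrder asc  = ⊆-isPartialOrder _
orient-⊆-isPartialOrder desc = Flip.isPartialOrder (⊆-isPartialOrder _)

height : Dir → ∀ {n} → Subset n → ℕ
height asc  {n} A = n ∸ ∣ A ∣
height desc     A = ∣ A ∣

height-decreasing : ∀ dir {n} {A B : Subset n} → orient dir _⊆_ A B → A ≢ B → height dir B < height dir A
height-decreasing asc  {n} {A} {B} A⊆B A≢B =
  ℕₚ.∸-monoʳ-< (ℕₚ.≰⇒> (A≢B ∘ ⊆-∣∣-≡ A⊆B)) (∣p∣≤n B)
height-decreasing desc A⊇B A≢B = ℕₚ.≰⇒> (A≢B ∘ sym ∘ ⊆-∣∣-≡ A⊇B)

module _ {X : Set} {_⊴_ : Rel X 0ℓ} (isPartialOrder : IsPartialOrder _≡_ _⊴_) (_≟_ : DecidableEquality X) where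

  private module ⊴ = IsPartialOrder isPartialOrder

  -- Descent on `height`. Membership in `Q` need not be decidable, so the maximal element is
  -- obtained only up to double negation.
  ¬¬-maximal : (height : X → ℕ) → (∀ {x y} → x ⊴ y → x ≢ y → height y < height x) →
    {Q : Pred X 0ℓ} → ∀ {x} → Q x → ¬ ¬ (∃[ y ] (Q y × x ⊴ y × (∀ {z} → Q z → y ⊴ z → y ≡ z)))
  ¬¬-maximal height decreasing {Q} {x} x∈Q ∄ = go (<-wellFounded (height x)) x∈Q ⊴.refl
    where
    top : ∀ {y} → (∀ {z} → height z < height y → Q z → ¬ x ⊴ z) → x ⊴ y → ∀ {z} → Q z → y ⊴ z → y ≡ z
    top {y} none x⊴y {z} z∈Q y⊴z with y ≟ z
    ... | yes y≡z = y≡z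
    ... | no  y≢z = contradiction (⊴.trans x⊴y y⊴z) (none (decreasing y⊴z y≢z) z∈Q)

    go : ∀ {y} → Acc _<_ (height y) → Q y → ¬ x ⊴ y
    go {y} (acc rec) y∈Q x⊴y = ∄ (y , y∈Q , x⊴y , top (λ z<y → go (rec z<y)) x⊴y)

  module Lowering {Y : Set} {_≈_ _≼_ : Rel Y 0ℓ} {o : Y} (o≼ : ∀ p → o ≼ p) (g : Y → X)
    (g-mono : ∀ {p q} → p ≼ q → g p ⊴ g q) (g-inj : ∀ {p q} → g p ≡ g q → p ≈ q) where

    -- The case split tests equality of the images, which `_≟_` decides; `g-inj` turns it into
    -- `p ≈ o`.
    lower : X → Y → X
    lower a p with g p ≟ g o
    ... | yes _ = a
    ... | no  _ = g p

    module _ {a : X} (a⊴ : a ⊴ g o) where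

      lower-bottom : lower a o ≡ a
      lower-bottom with g o ≟ g o
      ... | yes _   = refl
      ... | no o≢o = contradiction refl o≢o

      lower-mono : ∀ {p q} → p ≼ q → lower a p ⊴ lower a q
      lower-mono {p} {q} p≼q with g p ≟ g o | g q ≟ g o
      ... | yes _  | yes _  = ⊴.refl
      ... | yes _  | no _   = ⊴.trans a⊴ (g-mono (o≼ q))
      -- `g p` lies between `g o` and `g q`, and these coincide.
      ... | no p≢o | yes q≡o = contradiction (⊴.antisym (subst (g p ⊴_) q≡o (g-mono p≼q)) (g-mono (o≼ p))) p≢o
      ... | no _   | no _    = g-mono p≼q

      lower-inj : ∀ {p q} → lower a p ≡ lower a q → p ≈ q
      lower-inj {p} {q} eq with g p ≟ g o | g q ≟ g o
      ... | yes p≡o | yes q≡o = g-inj (trans p≡o (sym q≡o))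
      -- Here `a` equals `g q`, so `g q` is below `g o` and therefore equal to it.
      ... | yes _   | no q≢o  = contradiction (⊴.antisym (subst (_⊴ g o) eq a⊴) (g-mono (o≼ q))) q≢o
      ... | no p≢o  | yes _   = contradiction (⊴.antisym (subst (_⊴ g o) (sym eq) a⊴) (g-mono (o≼ p))) p≢o
      ... | no _    | no _    = g-inj eq

      -- A point off the bottom keeps its image, which lies above `g o` and so above `b`. As `b` is
      -- maximal in `Q`, the image is `b` itself, hence below `g o`, and antisymmetry makes it
      -- `g o`, which is excluded.
      lower-avoids : ∀ {Q : Pred X 0ℓ} {b} → a ⊴ b → b ⊴ g o → (∀ {z} → Q z → b ⊴ z → b ≡ z) →
        ∀ {p} → Q (lower a p) → p ≈ o
      lower-avoids a⊴b b⊴o b-top {p} gp∈Q with g p ≟ g o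
      ... | yes p≡o = g-inj p≡o
      ... | no  p≢o = contradiction (⊴.antisym (subst (_⊴ g o) (b-top gp∈Q (⊴.trans b⊴o o⊴p)) b⊴o) o⊴p) p≢o
        where o⊴p = g-mono (o≼ p)

-- Excluded middle holds up to double negation at each of the finitely many subsets, and induction
-- on `n` collects these instances.
¬¬-decidable : ∀ {n} (𝓕 : Family n) → ¬ ¬ Decidable 𝓕
¬¬-decidable {zero}  𝓕 ¬dec = ¬¬-excluded-middle λ d → ¬dec λ { V.[] → d }
¬¬-decidable {suc n} 𝓕 ¬dec =
  ¬¬-decidable (𝓕 ∘ (inside V.∷_)) λ in? → ¬¬-decidable (𝓕 ∘ (outside V.∷_)) λ out? →
  ¬dec λ { (inside V.∷ A) → in? A ; (outside V.∷ A) → out? A }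

-- Lubell bounds for families in the middle levels

InMiddle : ∀ {n} → ℕ → Family n → Set
InMiddle {n} m 𝓕 = ∀ A → 𝓕 A → m ≤ ∣ A ∣ × ∣ A ∣ + m ≤ n

InMiddle-weaken : ∀ {n m m′} {𝓕 𝓖 : Family n} → m′ ≤ m → (∀ {A} → 𝓖 A → 𝓕 A) → InMiddle m 𝓕 → InMiddle m′ 𝓖
InMiddle-weaken m′≤m 𝓖⊆𝓕 mid A A∈𝓖 with mid A (𝓖⊆𝓕 A∈𝓖)
... | m≤A , A+m≤n = ℕₚ.≤-trans m′≤m m≤A , ℕₚ.≤-trans (ℕₚ.+-monoʳ-≤ ∣ A ∣ m′≤m) A+m≤n

-- The avoidance condition is a parameter, so that the same bound speaks of `P`-free families and of
-- families without a partial copy of the chain.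
record LubellBound (Avoids : ∀ {n} → Family n → Set) (e : ℕ) : Set₁ where
  constructor _,_
  field
    margin  : ℕ
    lubell≤ : ∀ n (𝓕 : Family n) (𝓕? : Decidable 𝓕) → InMiddle margin 𝓕 → Avoids 𝓕 → lubell 𝓕? ℚ.≤ + e / 1

-- A family of `k` consecutive middle levels has Lubell value `k`, so the bound caps the number of
-- levels that can be free.
LevelsFree-bounded : ∀ {P e k} → LubellBound (Free P) e → LevelsFree P k → k ≤ e
LevelsFree-bounded {P} {e} {k} (m , lubell≤) free = /1-cancel-≤ (subst (ℚ._≤ + e / 1)
  (lubell-band m k (ℕₚ.m≤n⇒m≤1+n (ℕₚ.m≤m+n (m + k) m)))
  (lubell≤ n (band n m k) (band? n m k)
    (λ A (m≤A , A<) → m≤A , ℕₚ.+-monoˡ-≤ m (ℕₚ.<⇒≤ A<))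
    (λ P⊑ → free n (+ m) (⊑-trans {P} {familyPoset (band n m k)} {familyPoset (levels n (+ m) k)} P⊑
      (familyPoset-mono (λ {A} → band⊆levels {A}))))))
  where
  -- The sizes from `m` to `m + k - 1` need a margin of `m` on both sides.
  n = m + k + m
  band⊆levels : ∀ {A} → band n m k A → levels n (+ m) k A
  band⊆levels {A} (m≤A , A<) = ∣ A ∣ ∸ m , ℕₚ.+-cancelˡ-< m _ _ (subst (_< m + k) (sym eq) A<) , cong +_ (sym eq)
    where
    eq : m + (∣ A ∣ ∸ m) ≡ ∣ A ∣
    eq = ℕₚ.m+[n∸m]≡n m≤A

orient-mono : ∀ dir {A B : Set} {R : Rel A 0ℓ} {S : Rel B 0ℓ} (f : A → B) →
  (∀ {x y} → R x y → S (f x) (f y)) → ∀ {x y} → orient dir R x y → orient dir S (f x) (f y)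
orient-mono asc  f f-mono = f-mono
orient-mono desc f f-mono = f-mono

unorient-mono : ∀ dir {A B : Set} {R : Rel A 0ℓ} {S : Rel B 0ℓ} (f : A → B) →
  (∀ {x y} → orient dir R x y → orient dir S (f x) (f y)) → ∀ {x y} → R x y → S (f x) (f y)
unorient-mono asc  f f-mono = f-mono
unorient-mono desc f f-mono = f-mono

-- Gluing

module _ {r} (S : Fin r → Σ Pos Interval) where

  private
    module S i = Poset (proj₁ (S i))

    J : ∀ i → Interval (proj₁ (S i))
    J i = proj₂ (S i)

    Point : Set
    Point = Σ (Fin r) S.Carrier

  -- z ∈ S j lies below y ∈ S i.  Passing down through the summands between i and j is possible
  -- only when the intervals there are single points.
  data Below i (y : S.Carrier i) : Point → Set where
    here  : ∀ {z} → S._≤_ i z y → Below i y (i , z)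
    lower : ∀ {j z} → toℕ j < toℕ i → S._≤_ j z (max (J j)) → S._≤_ i (min (J i)) y → Below i y (j , z)
    upper : ∀ {j z} → toℕ i < toℕ j → S._≤_ j z (min (J j)) →
      (∀ k → toℕ i < toℕ k → toℕ k < toℕ j → S._≤_ k (max (J k)) (min (J k))) →
      S._≤_ i (max (J i)) y → Below i y (j , z)

  Below-step : ∀ {i y p q} → Step S p q → Below i y q → Below i y p
  Below-step (within j x≤y) (here y≤)          = here (S.trans j x≤y y≤)
  Below-step (within j x≤y) (lower j<i y≤ ≤t)  = lower j<i (S.trans j x≤y y≤) ≤t
  Below-step (within j x≤y) (upper i<j y≤ t ≤t) = upper i<j (S.trans j x≤y y≤) t ≤t
  Below-step (up j k eq) (here min≤)           = lower (ℕₚ.≤-reflexive (sym eq)) (S.refl j) min≤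
  Below-step (up j k eq) (lower k<i _ ≤t)      = lower (ℕₚ.<-trans (ℕₚ.≤-reflexive (sym eq)) k<i) (S.refl j) ≤t
  -- The step starts in summand `j`, just before `k`. If `j` still comes after `i`, its interval is
  -- one of the single points recorded by `t`; otherwise `j` is `i`.
  Below-step {i} (up j k eq) (upper i<k _ t ≤t) with toℕ i ℕₚ.≟ toℕ j
  ... | no i≢j = upper i<j (t j i<j (ℕₚ.≤-reflexive (sym eq)))
                   (λ l i<l l<j → t l i<l (ℕₚ.<-trans l<j (ℕₚ.≤-reflexive (sym eq)))) ≤t
    where i<j = ℕₚ.≤∧≢⇒< (ℕₚ.≤-pred (subst (toℕ i <_) eq i<k)) i≢j
  ... | yes i≡j with refl ← Finₚ.toℕ-injective i≡j = here ≤t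
  Below-step (down j k eq) (here max≤)         =
    upper (ℕₚ.≤-reflexive (sym eq)) (S.refl k)
      (λ l i<l l<k → contradiction (ℕₚ.≤-pred (subst (toℕ l <_) eq l<k)) (ℕₚ.<⇒≱ i<l)) max≤
  Below-step {i} (down j k eq) (lower j<i _ ≤t) with toℕ k ℕₚ.≟ toℕ i
  ... | no k≢i = lower (ℕₚ.≤∧≢⇒< (subst (_≤ toℕ i) (sym eq) j<i) k≢i) (min≼max (J k)) ≤t
  ... | yes k≡i with refl ← Finₚ.toℕ-injective k≡i = here ≤t
  Below-step {i} (down j k eq) (upper i<j max≤min t ≤t) =
    upper (ℕₚ.<-trans i<j (ℕₚ.≤-reflexive (sym eq))) (S.refl k) between ≤t
    where
    between : ∀ l → toℕ i < toℕ l → toℕ l < toℕ k → S._≤_ l (max (J l)) (min (J l))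
    between l i<l l<k with toℕ l ℕₚ.≟ toℕ j
    ... | no l≢j = t l i<l (ℕₚ.≤∧≢⇒< (ℕₚ.≤-pred (subst (toℕ l <_) eq l<k)) l≢j)
    ... | yes l≡j with refl ← Finₚ.toℕ-injective l≡j = max≤min

  Star⇒Below : ∀ {i y p} → Star (Step S) p (i , y) → Below i y p
  Star⇒Below {i} ε        = here (S.refl i)
  Star⇒Below     (s ◅ ss) = Below-step s (Star⇒Below ss)

  -- Within one summand only `here` is possible, since the other constructors of `Below` change the
  -- index. Thus gluing adds no relation inside a summand.
  Star-reflects-≤ : ∀ {i x y} → Star (Step S) (i , x) (i , y) → S._≤_ i x y
  Star-reflects-≤ {i} {x} {y} x≤y = go (Star⇒Below x≤y)
    where
    go : Below i y (i , x) → S._≤_ i x y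
    go (here x≤y)          = x≤y
    go (lower i<i _ _)     = contradiction i<i (ℕₚ.<-irrefl refl)
    go (upper i<i _ _ _)   = contradiction i<i (ℕₚ.<-irrefl refl)

  -- A copy of the summands with index in D; the values of h at other indices are junk.
  record Partial (D : Fin r → Set) {n} (𝓕 : Family n) : Set where
    field
      h      : ∀ i → S.Carrier i → Subset n
      h∈     : ∀ {i} → D i → ∀ x → 𝓕 (h i x)
      h-mono : ∀ {i} → D i → ∀ {x y} → S._≤_ i x y → h i x ⊆ h i y
      h-glue : ∀ {i j} → D i → D j → toℕ j ≡ suc (toℕ i) → h i (max (J i)) ≡ h j (min (J j))
      -- One direction suffices: the equation can be reversed, and both directions together are
      -- equality in `⊕I S`.
      h-inj  : ∀ {i j x y} → D i → D j → h i x ≡ h j y → Star (Step S) (i , x) (j , y)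

  ⊑⇒Partial : ∀ {D c n} {𝓕 : Family n} → (∀ {i} → D i → i ≡ c) → proj₁ (S c) ⊑ familyPoset 𝓕 → Partial D 𝓕
  ⊑⇒Partial {D} {c} {n} {𝓕} D⇒≡c (g , g-inj) = record
    { h = h ; h∈ = λ {i} → h∈ i ; h-mono = λ {i} → h-mono i ; h-glue = h-glue ; h-inj = λ {i} {j} → h-inj i j }
    where
    h : ∀ i → S.Carrier i → Subset n
    h i x with i Finₚ.≟ c
    ... | yes refl = proj₁ (⟦ g ⟧ x)
    -- The empty set is a default value; `D` holds at most at `c`.
    ... | no _     = ⊥
    h∈ : ∀ i → D i → ∀ x → 𝓕 (h i x)
    h∈ i d x with i Finₚ.≟ c
    ... | yes refl = proj₂ (⟦ g ⟧ x)
    ... | no i≢c   = contradiction (D⇒≡c d) i≢c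
    h-mono : ∀ i → D i → ∀ {x y} → S._≤_ i x y → h i x ⊆ h i y
    h-mono i d x≤y with i Finₚ.≟ c
    ... | yes refl = mono g x≤y
    ... | no i≢c   = contradiction (D⇒≡c d) i≢c
    h-glue : ∀ {i j} → D i → D j → toℕ j ≡ suc (toℕ i) → h i (max (J i)) ≡ h j (min (J j))
    h-glue d d′ eq with refl ← D⇒≡c d | refl ← D⇒≡c d′ = contradiction (sym eq) ℕₚ.1+n≢n
    h-inj : ∀ i j {x y} → D i → D j → h i x ≡ h j y → Star (Step S) (i , x) (j , y)
    h-inj i j d d′ eq with i Finₚ.≟ c | j Finₚ.≟ c
    ... | yes refl | yes refl = within c (S.reflexive c (g-inj eq)) ◅ ε
    ... | no i≢c   | _        = contradiction (D⇒≡c d) i≢c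
    ... | _        | no j≢c   = contradiction (D⇒≡c d′) j≢c

  -- S c is attached at a single point: its bottom (top, if dir = desc) u is glued to v ∈ S d.
  module Extend (dir : Dir) {D D′ : Fin r → Set} {c d : Fin r}
    (D′⇒D : ∀ {i} → D′ i → i ≢ c → D i) (d∈D : D d)
    {u : S.Carrier c} {v : S.Carrier d} (u-bottom : ∀ x → orient dir (S._≤_ c) u x)
    (u≤v : Star (Step S) (c , u) (d , v)) (v≤u : Star (Step S) (d , v) (c , u))
    -- A member of `D` next to `c` is glued to it at `v` and `u`, whether it comes just before or
    -- just after `c`.
    (glue-in : ∀ {i} → D i → toℕ c ≡ suc (toℕ i) → _≡_ {A = Point} (i , max (J i)) (d , v) × min (J c) ≡ u)
    (glue-out : ∀ {j} → D j → toℕ j ≡ suc (toℕ c) → _≡_ {A = Point} (j , min (J j)) (d , v) × max (J c) ≡ u)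
    where

    -- The family 𝓤 from the outline of the proof; for `desc` the copy of `S c` lies below `A`.
    Supported : ∀ {n} → Family n → Family n
    Supported 𝓕 A = 𝓕 A × Σ (proj₁ (S c) ⊑ familyPoset 𝓕) λ (g , _) → ∀ x → orient dir _⊆_ A (proj₁ (⟦ g ⟧ x))

    Unsupported : ∀ {n} → Family n → Family n
    Unsupported 𝓕 A = 𝓕 A × ¬ Supported 𝓕 A

    -- In a copy of `S c`, the image of `u` would be supported by that very copy.
    Unsupported-free : ∀ {n} (𝓕 : Family n) → Free (proj₁ (S c)) (Unsupported 𝓕)
    Unsupported-free 𝓕 (g , g-inj) = proj₂ (proj₂ (⟦ g ⟧ u))
      ( proj₁ (proj₂ (⟦ g ⟧ u))
      , embed (proj₁ (S c)) 𝓕 (proj₁ ∘ ⟦ g ⟧) (proj₁ ∘ proj₂ ∘ ⟦ g ⟧) (mono g) g-inj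
      , λ x → orient-mono dir {R = S._≤_ c} {S = _⊆_} (proj₁ ∘ ⟦ g ⟧) (mono g) {u} {x} (u-bottom x))

    -- Every set of the partial copy has a copy of `S c` beyond it. The one beyond a maximal set `B`
    -- can meet the partial copy only at `B`, so moving its end `u` to `A` makes the two meet
    -- exactly at the gluing point.
    extend : ∀ {n} {𝓕 : Family n} → Partial D (Supported 𝓕) → ¬ ¬ Partial D′ 𝓕
    extend {n} {𝓕} partial = ¬¬-map build
      (¬¬-maximal isPO _≟ˢ_ (height dir) (height-decreasing dir) {Image} {A} (d , d∈D , v , refl))
      where
      open Partial partial
      isPO = orient-⊆-isPartialOrder dir {n}
      module isPO = IsPartialOrder isPO
      _⊴_ = orient dir (_⊆_ {n})

      Image : Family n
      Image B = ∃[ i ] (D i × ∃[ x ] h i x ≡ B)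

      A : Subset n
      A = h d v

      build : (∃[ B ] (Image B × A ⊴ B × (∀ {E} → Image E → B ⊴ E → B ≡ E))) → Partial D′ 𝓕
      build (B , (b , b∈D , y , refl) , A⊴B , B-top) with h∈ b∈D y
      ... | _ , (g , g-inj) , B⊴g = record
        { h      = h′
        ; h∈     = λ {i} → h′∈ i
        ; h-mono = λ {i} → h′-mono i
        ; h-glue = λ {i} {j} → h′-glue i j
        ; h-inj  = λ {i} {j} → h′-inj i j
        }
        where
        G : S.Carrier c → Subset n
        G = proj₁ ∘ ⟦ g ⟧

        module L = Lowering isPO _≟ˢ_ {_≈_ = S._≈_ c} {_≼_ = orient dir (S._≤_ c)} {o = u} u-bottom G
          (λ {p} {q} → orient-mono dir {R = S._≤_ c} {S = _⊆_} G (mono g) {p} {q}) g-inj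

        A⊴Gu : A ⊴ G u
        A⊴Gu = isPO.trans A⊴B (B⊴g u)

        G′ : S.Carrier c → Subset n
        G′ = L.lower A

        G′∈ : ∀ x → 𝓕 (G′ x)
        G′∈ x with G x ≟ˢ G u
        -- The moved end takes the value `A`, which is in 𝓕 because supported sets are members of 𝓕.
        ... | yes _ = proj₁ (h∈ d∈D v)
        ... | no _  = proj₂ (⟦ g ⟧ x)

        G′-mono : ∀ {x y} → S._≤_ c x y → G′ x ⊆ G′ y
        G′-mono = unorient-mono dir {R = S._≤_ c} {S = _⊆_} G′ (λ {p} {q} → L.lower-mono A⊴Gu {p} {q})

        G′u≡A : G′ u ≡ A
        G′u≡A = L.lower-bottom A⊴Gu

        G′-cong : ∀ {x y} → S._≈_ c x y → G′ x ≡ G′ y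
        G′-cong x≈y = ⊆-antisym (G′-mono (S.reflexive c x≈y)) (G′-mono (S.reflexive c (S.Eq.sym c x≈y)))

        -- `B` is maximal in `Image`, so among the sets of the moved copy only the one at `u` can
        -- belong to the partial copy.
        meets-at-u : ∀ {j x y} → D j → G′ x ≡ h j y → S._≈_ c x u × A ≡ h j y
        meets-at-u {j} {x} {y} j∈D eq = x≈u , trans (sym (trans (G′-cong x≈u) G′u≡A)) eq
          where
          x≈u : S._≈_ c x u
          x≈u = L.lower-avoids A⊴Gu {Q = Image} A⊴B (B⊴g u) B-top (j , j∈D , y , sym eq)

        h′ : ∀ i → S.Carrier i → Subset n
        h′ i x with i Finₚ.≟ c
        ... | yes refl = G′ x
        ... | no _     = h i x

        h′∈ : ∀ i → D′ i → ∀ x → 𝓕 (h′ i x)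
        h′∈ i i∈D′ x with i Finₚ.≟ c
        ... | yes refl = G′∈ x
        ... | no i≢c   = proj₁ (h∈ (D′⇒D i∈D′ i≢c) x)

        h′-mono : ∀ i → D′ i → ∀ {x y} → S._≤_ i x y → h′ i x ⊆ h′ i y
        h′-mono i i∈D′ with i Finₚ.≟ c
        ... | yes refl = G′-mono
        ... | no i≢c   = h-mono (D′⇒D i∈D′ i≢c)

        h′-glue : ∀ i j → D′ i → D′ j → toℕ j ≡ suc (toℕ i) → h′ i (max (J i)) ≡ h′ j (min (J j))
        h′-glue i j i∈D′ j∈D′ eq with i Finₚ.≟ c | j Finₚ.≟ c
        ... | yes refl | yes refl = contradiction (sym eq) ℕₚ.1+n≢n
        ... | yes refl | no j≢c   with glue-out (D′⇒D j∈D′ j≢c) eq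
        ...   | eq-v , eq-u = trans (cong G′ eq-u) (trans G′u≡A (sym (cong (uncurry h) eq-v)))
        h′-glue i j i∈D′ j∈D′ eq | no i≢c | yes refl with glue-in (D′⇒D i∈D′ i≢c) eq
        ...   | eq-v , eq-u = trans (cong (uncurry h) eq-v) (trans (sym G′u≡A) (sym (cong G′ eq-u)))
        h′-glue i j i∈D′ j∈D′ eq | no i≢c | no j≢c = h-glue (D′⇒D i∈D′ i≢c) (D′⇒D j∈D′ j≢c) eq

        h′-inj : ∀ i j {x y} → D′ i → D′ j → h′ i x ≡ h′ j y → Star (Step S) (i , x) (j , y)
        h′-inj i j i∈D′ j∈D′ eq with i Finₚ.≟ c | j Finₚ.≟ c
        ... | yes refl | yes refl = within c (S.reflexive c (L.lower-inj A⊴Gu eq)) ◅ ε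
        ... | yes refl | no j≢c   with meets-at-u (D′⇒D j∈D′ j≢c) eq
        -- The path runs from `x` to `u`, through the gluing to `v`, and on to `y`, because `h`
        -- agrees at `v` and `y`.
        ...   | x≈u , A≡ = within c (S.reflexive c x≈u) ◅ u≤v ◅◅ h-inj d∈D (D′⇒D j∈D′ j≢c) A≡
        h′-inj i j i∈D′ j∈D′ eq | no i≢c | yes refl with meets-at-u (D′⇒D i∈D′ i≢c) (sym eq)
        ...   | y≈u , A≡ = h-inj (D′⇒D i∈D′ i≢c) d∈D (sym A≡) ◅◅ v≤u ◅◅ within c (S.reflexive c (S.Eq.sym c y≈u)) ◅ ε
        h′-inj i j i∈D′ j∈D′ eq | no i≢c | no j≢c = h-inj (D′⇒D i∈D′ i≢c) (D′⇒D j∈D′ j≢c) eq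

    -- Split 𝓕 into supported and unsupported sets: a partial copy in the first part would extend,
    -- and the second part is free of `S c`. The larger margin suits both.
    extend-bound : ∀ {e₁ e₂} → LubellBound (¬_ ∘ Partial D) e₁ → LubellBound (Free (proj₁ (S c))) e₂ →
      LubellBound (¬_ ∘ Partial D′) (e₁ + e₂)
    extend-bound {e₁} {e₂} (m₁ , bound₁) (m₂ , bound₂) = m₁ ⊔ m₂ , bound
      where
      bound : ∀ n (𝓕 : Family n) (𝓕? : Decidable 𝓕) → InMiddle (m₁ ⊔ m₂) 𝓕 → ¬ Partial D′ 𝓕 →
        lubell 𝓕? ℚ.≤ + (e₁ + e₂) / 1
      -- `Supported 𝓕` need not be decidable, but the inequality between rationals is, so the double
      -- negation can be removed.
      bound n 𝓕 𝓕? mid ∄ = decidable-stable (lubell 𝓕? ℚₚ.≤? + (e₁ + e₂) / 1)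
        (¬¬-map via (¬¬-decidable (Supported 𝓕)))
        where
        via : Decidable (Supported 𝓕) → lubell 𝓕? ℚ.≤ + (e₁ + e₂) / 1
        via supp? = lubell-≤-split 𝓕? supp? unsupp? split proj₁ proj₁ (λ s u → proj₂ u s) {e₁} {e₂}
          (bound₁ n (Supported 𝓕) supp?
            (InMiddle-weaken {𝓕 = 𝓕} {Supported 𝓕} (ℕₚ.m≤m⊔n m₁ m₂) proj₁ mid) (λ p → extend p ∄))
          (bound₂ n (Unsupported 𝓕) unsupp?
            (InMiddle-weaken {𝓕 = 𝓕} {Unsupported 𝓕} (ℕₚ.m≤n⊔m m₁ m₂) proj₁ mid) (Unsupported-free 𝓕))
          where
          unsupp? : Decidable (Unsupported 𝓕)
          unsupp? A = 𝓕? A ×-dec ¬? (supp? A)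

          split : ∀ {A} → 𝓕 A → Supported 𝓕 A ⊎ Unsupported 𝓕 A
          split {A} A∈𝓕 with supp? A
          ... | yes s = inj₁ s
          ... | no ¬s = inj₂ (A∈𝓕 , ¬s)

-- Adding up bounds along the chain of summands

module _ {r} (S : Fin r → Σ Pos Interval) (e : Fin r → ℕ) (isE : ∀ i → IsE (proj₁ (S i)) (e i))
  (bounded : ∀ i → LubellBound (Free (proj₁ (S i))) (e i)) (large : ∀ i → IsLarge (proj₁ (S i)) (proj₂ (S i))) where

  private
    J : ∀ i → Interval (proj₁ (S i))
    J i = proj₂ (S i)

    Point : Set
    Point = Σ (Fin r) λ i → Poset.Carrier (proj₁ (S i))

  record Embedding (n : ℕ) : Set where
    field
      f      : Point → Subset n
      f-mono : ∀ {p q} → Star (Step S) p q → f p ⊆ f q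
      f-inj  : ∀ {p q} → f p ≡ f q → Star (Step S) p q

    glued : ∀ {i j} → toℕ j ≡ suc (toℕ i) → ∣ f (i , max (J i)) ∣ ≡ ∣ f (j , min (J j)) ∣
    glued {i} {j} eq = ℕₚ.≤-antisym (p⊆q⇒∣p∣≤∣q∣ (f-mono (up i j eq ◅ ε))) (p⊆q⇒∣p∣≤∣q∣ (f-mono (down i j eq ◅ ε)))

    gap : ∀ i → ∣ f (i , min (J i)) ∣ + e i ≤ ∣ f (i , max (J i)) ∣
    gap i = interval-gap (J i) (large-LevelsFree (J i) (isE i) (large i)) (λ x → f (i , x))
      (λ x≤y → f-mono (within i x≤y ◅ ε))
      -- `f-inj` gives comparisons in the glued order; `Star-reflects-≤` brings both directions back
      -- to the summand.
      (λ eq → Poset.antisym (proj₁ (S i)) (Star-reflects-≤ S (f-inj eq)) (Star-reflects-≤ S (f-inj (sym eq))))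

  SizeGap : Fin r → Fin r → ℕ → Set
  SizeGap lo hi E = ∀ {n} (ϕ : Embedding n) → let open Embedding ϕ in
    ∣ f (lo , min (J lo)) ∣ + E ≤ ∣ f (hi , max (J hi)) ∣

  Between : Fin r → Fin r → Fin r → Set
  Between lo hi i = toℕ lo ≤ toℕ i × toℕ i ≤ toℕ hi

  -- One number `E` serves twice: for the complete chain the Lubell bound shows that e is at most
  -- `E`, and the size gap that `E` consecutive levels contain no copy.
  Bounded : Fin r → Fin r → Set₁
  Bounded lo hi = ∃[ E ] (LubellBound (¬_ ∘ Partial S (Between lo hi)) E × SizeGap lo hi E)

  Bounded-single : ∀ i → Bounded i i
  Bounded-single i =
    e i ,
    (margin , λ n 𝓕 𝓕? mid ∄ → lubell≤ n 𝓕 𝓕? mid λ S⊑𝓕 → ∄ (⊑⇒Partial S single S⊑𝓕)) ,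
    λ ϕ → Embedding.gap ϕ i
    where
    open LubellBound (bounded i)
    single : ∀ {j} → Between i i j → j ≡ i
    single (i≤j , j≤i) = Finₚ.toℕ-injective (ℕₚ.≤-antisym j≤i i≤j)

  -- The large interval of `c` starts at its bottom, so `c` is attached at the single point
  -- `max (J d)`; the size gaps add up because glued points have images of equal size.
  Bounded-up : ∀ {lo d c} → toℕ lo ≤ toℕ d → toℕ c ≡ suc (toℕ d) → Has-0̂ (proj₁ (S c)) →
    Bounded lo d → Bounded lo c
  Bounded-up {lo} {d} {c} lo≤d c≡1+d 0̂ (E , lubell≤ , sizeGap) =
    E + e c , E.extend-bound lubell≤ (bounded c) , λ ϕ → sizeGap′ ϕ
    where
    narrow : ∀ {i} → Between lo c i → i ≢ c → Between lo d i
    narrow (lo≤i , i≤c) i≢c = lo≤i , ℕₚ.≤-pred (subst (_ <_) c≡1+d (ℕₚ.≤∧≢⇒< i≤c (i≢c ∘ Finₚ.toℕ-injective)))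

    glue-in : ∀ {i} → Between lo d i → toℕ c ≡ suc (toℕ i) → (i , max (J i)) ≡ (d , max (J d)) × min (J c) ≡ min (J c)
    glue-in _ c≡1+i with refl ← Finₚ.toℕ-injective (ℕₚ.suc-injective (trans (sym c≡1+i) c≡1+d)) = refl , refl

    -- The index after `c` lies beyond `d`, so this case is void.
    glue-out : ∀ {j} → Between lo d j → toℕ j ≡ suc (toℕ c) → (j , min (J j)) ≡ (d , max (J d)) × max (J c) ≡ min (J c)
    glue-out (_ , j≤d) j≡1+c = contradiction j≤d
      (ℕₚ.<⇒≱ (subst (toℕ d <_) (sym j≡1+c) (ℕₚ.m≤n⇒m≤1+n (ℕₚ.≤-reflexive (sym c≡1+d)))))

    module E = Extend S asc {Between lo d} {Between lo c} {c} {d} narrow (lo≤d , ℕₚ.≤-refl) {min (J c)} {max (J d)}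
      (min-minimum {I = J c} (large c) 0̂) (down d c c≡1+d ◅ ε) (up d c c≡1+d ◅ ε) glue-in glue-out

    sizeGap′ : SizeGap lo c (E + e c)
    sizeGap′ ϕ = begin
      ∣ f (lo , min (J lo)) ∣ + (E + e c) ≡⟨ ℕₚ.+-assoc ∣ f (lo , min (J lo)) ∣ E (e c) ⟨
      ∣ f (lo , min (J lo)) ∣ + E + e c   ≤⟨ ℕₚ.+-monoˡ-≤ (e c) (sizeGap ϕ) ⟩
      ∣ f (d , max (J d)) ∣ + e c         ≡⟨ cong (_+ e c) (glued c≡1+d) ⟩
      ∣ f (c , min (J c)) ∣ + e c         ≤⟨ gap c ⟩
      ∣ f (c , max (J c)) ∣               ∎
      where
      open Embedding ϕ
      open ℕₚ.≤-Reasoning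

  -- Dual to `Bounded-up`: the large interval of `c` ends at its top, which meets the chain at
  -- `min (J d)`.
  Bounded-down : ∀ {hi d c} → toℕ d ≤ toℕ hi → toℕ d ≡ suc (toℕ c) → Has-1̂ (proj₁ (S c)) →
    Bounded d hi → Bounded c hi
  Bounded-down {hi} {d} {c} d≤hi d≡1+c 1̂ (E , lubell≤ , sizeGap) =
    E + e c , E.extend-bound lubell≤ (bounded c) , λ ϕ → sizeGap′ ϕ
    where
    narrow : ∀ {i} → Between c hi i → i ≢ c → Between d hi i
    narrow (c≤i , i≤hi) i≢c = subst (_≤ _) (sym d≡1+c) (ℕₚ.≤∧≢⇒< c≤i (i≢c ∘ sym ∘ Finₚ.toℕ-injective)) , i≤hi

    glue-in : ∀ {i} → Between d hi i → toℕ c ≡ suc (toℕ i) → (i , max (J i)) ≡ (d , min (J d)) × min (J c) ≡ max (J c)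
    glue-in (d≤i , _) c≡1+i = contradiction d≤i
      (ℕₚ.<⇒≱ (subst (_ <_) (sym d≡1+c) (ℕₚ.m≤n⇒m≤1+n (ℕₚ.≤-reflexive (sym c≡1+i)))))

    glue-out : ∀ {j} → Between d hi j → toℕ j ≡ suc (toℕ c) → (j , min (J j)) ≡ (d , min (J d)) × max (J c) ≡ max (J c)
    glue-out _ j≡1+c with refl ← Finₚ.toℕ-injective (trans j≡1+c (sym d≡1+c)) = refl , refl

    module E = Extend S desc {Between d hi} {Between c hi} {c} {d} narrow (ℕₚ.≤-refl , d≤hi) {max (J c)} {min (J d)}
      (max-maximum {I = J c} (large c) 1̂) (up c d d≡1+c ◅ ε) (down c d d≡1+c ◅ ε) glue-in glue-out

    sizeGap′ : SizeGap c hi (E + e c)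
    sizeGap′ ϕ = begin
      ∣ f (c , min (J c)) ∣ + (E + e c)   ≡⟨ cong (λ k → ∣ f (c , min (J c)) ∣ + k) (ℕₚ.+-comm E (e c)) ⟩
      ∣ f (c , min (J c)) ∣ + (e c + E)   ≡⟨ ℕₚ.+-assoc ∣ f (c , min (J c)) ∣ (e c) E ⟨
      ∣ f (c , min (J c)) ∣ + e c + E     ≤⟨ ℕₚ.+-monoˡ-≤ E (gap c) ⟩
      ∣ f (c , max (J c)) ∣ + E           ≡⟨ cong (_+ E) (glued d≡1+c) ⟩
      ∣ f (d , min (J d)) ∣ + E           ≤⟨ sizeGap ϕ ⟩
      ∣ f (hi , max (J hi)) ∣             ∎
      where
      open Embedding ϕ
      open ℕₚ.≤-Reasoning

  module _ (p : Fin r) (0̂-above : ∀ {i} → toℕ p < toℕ i → Has-0̂ (proj₁ (S i)))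
    (1̂-below : ∀ {i} → toℕ i < toℕ p → Has-1̂ (proj₁ (S i))) where

    -- The chain grows upwards from `p`, with `k` counting the summands added.
    Bounded-from : ∀ k {hi} → toℕ hi ≡ k + toℕ p → Bounded p hi
    Bounded-from zero         hi≡p with refl ← Finₚ.toℕ-injective hi≡p = Bounded-single p
    Bounded-from (suc k) {hi} hi≡  =
      Bounded-up {d = d} (subst (toℕ p ≤_) (sym d≡) (ℕₚ.m≤n+m (toℕ p) k)) (trans hi≡ (cong suc (sym d≡)))
        (0̂-above (subst (toℕ p <_) (sym hi≡) (s≤s (ℕₚ.m≤n+m (toℕ p) k)))) (Bounded-from k d≡)
      where
      d<r : k + toℕ p < r
      d<r = ℕₚ.≤-trans (ℕₚ.≤-reflexive (sym hi≡)) (Finₚ.toℕ≤n hi)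
      d = fromℕ< d<r
      d≡ : toℕ d ≡ k + toℕ p
      d≡ = Finₚ.toℕ-fromℕ< d<r

    -- Once `Bounded-from` has built the upper part, the chain grows downwards, with `k` counting
    -- the summands added below `p`.
    Bounded-all : ∀ k {lo hi} → toℕ p ≡ k + toℕ lo → toℕ p ≤ toℕ hi → Bounded lo hi
    Bounded-all zero    {hi = hi} p≡lo p≤hi with refl ← Finₚ.toℕ-injective p≡lo =
      Bounded-from (toℕ hi ∸ toℕ p) (sym (ℕₚ.m∸n+n≡m p≤hi))
    Bounded-all (suc k) {lo} p≡ p≤hi =
      Bounded-down {d = d} (ℕₚ.≤-trans d≤p p≤hi) d≡ (1̂-below (subst (toℕ lo <_) (sym p≡) (s≤s (ℕₚ.m≤n+m (toℕ lo) k))))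
        (Bounded-all k (trans p≡ (trans (sym (ℕₚ.+-suc k (toℕ lo))) (cong (λ l → k + l) (sym d≡)))) p≤hi)
      where
      1+lo≤p : suc (toℕ lo) ≤ toℕ p
      1+lo≤p = subst (suc (toℕ lo) ≤_) (sym p≡) (s≤s (ℕₚ.m≤n+m (toℕ lo) k))
      d<r : suc (toℕ lo) < r
      d<r = ℕₚ.≤-<-trans 1+lo≤p (Finₚ.toℕ<n p)
      d = fromℕ< d<r
      d≡ : toℕ d ≡ suc (toℕ lo)
      d≡ = Finₚ.toℕ-fromℕ< d<r
      d≤p : toℕ d ≤ toℕ p
      d≤p = subst (_≤ toℕ p) (sym d≡) 1+lo≤p

  -- From the complete chain to L-boundedness

  Partial⇒⊑ : ∀ {D n} {𝓕 : Family n} → (∀ i → D i) → Partial S D 𝓕 → ⊕I S ⊑ familyPoset 𝓕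
  Partial⇒⊑ {𝓕 = 𝓕} total partial = embed (⊕I S) 𝓕 (λ (i , x) → h i x) (λ (i , x) → h∈ (total i) x) Star-mono
    (λ eq → h-inj (total _) (total _) eq , h-inj (total _) (total _) (sym eq))
    where
    open Partial partial
    Step-mono : ∀ {i x j y} → Step S (i , x) (j , y) → h i x ⊆ h j y
    Step-mono (within i x≤y) = h-mono (total i) x≤y
    Step-mono (up i j eq)    = subst (h i (max (J i)) ⊆_) (h-glue (total i) (total j) eq) ⊆-refl
    Step-mono (down i j eq)  = subst (_⊆ h i (max (J i))) (h-glue (total i) (total j) eq) ⊆-refl
    Star-mono : ∀ {p q} → Star (Step S) p q → h (proj₁ p) (proj₂ p) ⊆ h (proj₁ q) (proj₂ q)
    Star-mono ε        = ⊆-refl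
    Star-mono (s ◅ ss) = ⊆-trans (Step-mono s) (Star-mono ss)

  Bounded⇒LBounded : ∀ {lo hi} → (∀ i → Between lo hi i) → Bounded lo hi → LBounded (⊕I S)
  Bounded⇒LBounded {lo} {hi} total (E , partial-bound , sizeGap) =
    margin , E , (levels-free , λ k → LevelsFree-bounded {⊕I S} bound) , LubellBound.lubell≤ bound
    where
    open LubellBound partial-bound

    bound : LubellBound (Free (⊕I S)) E
    bound = margin , λ n 𝓕 𝓕? mid free → lubell≤ n 𝓕 𝓕? mid λ partial → free (Partial⇒⊑ total partial)

    levels-free : LevelsFree (⊕I S) E
    -- Inside `E` consecutive levels, the image of `max (J hi)` exceeds that of `min (J lo)` by less
    -- than `E` in size, against `sizeGap`.
    levels-free n s (g , g-inj) with proj₂ (⟦ g ⟧ (lo , min (J lo))) | proj₂ (⟦ g ⟧ (hi , max (J hi)))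
    ... | j₁ , _ , eq₁ | j₂ , j₂<E , eq₂ = ℤₚ.<-irrefl refl (begin-strict
      + ∣ f (hi , max (J hi)) ∣              ≡⟨ eq₂ ⟩
      s ℤ.+ + j₂                            <⟨ ℤₚ.+-monoʳ-< s (ℤ.+<+ (ℕₚ.<-≤-trans j₂<E (ℕₚ.m≤n+m E j₁))) ⟩
      s ℤ.+ + (j₁ + E)                      ≡⟨ ℤₚ.+-assoc s (+ j₁) (+ E) ⟨
      s ℤ.+ + j₁ ℤ.+ + E                    ≡⟨ cong (ℤ._+ + E) eq₁ ⟨
      + (∣ f (lo , min (J lo)) ∣ + E)       ≤⟨ ℤ.+≤+ (sizeGap record { f = f ; f-mono = mono g ; f-inj = λ eq → lhs≤rhs (g-inj eq) }) ⟩
      + ∣ f (hi , max (J hi)) ∣              ∎)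
      where
      open ℤₚ.≤-Reasoning
      f : Point → Subset n
      f p = proj₁ (⟦ g ⟧ p)

-- `p` is the summand from which the chain is built; every later one has a bottom for `Bounded-up`,
-- every earlier one a top for `Bounded-down`.
⊕I-LBounded : ∀ {r} (S : Fin r → Σ Pos Interval) → (∀ i → LBounded (proj₁ (S i))) →
  (∀ i → IsLarge (proj₁ (S i)) (proj₂ (S i))) → (p : Fin r) →
  (∀ {i} → toℕ p < toℕ i → Has-0̂ (proj₁ (S i))) → (∀ {i} → toℕ i < toℕ p → Has-1̂ (proj₁ (S i))) → LBounded (⊕I S)
⊕I-LBounded {suc r} S bounded large p 0̂-above 1̂-below =
  Bounded⇒LBounded S e isE bound large {zero} {fromℕ r} (λ i → z≤n , Finₚ.≤fromℕ i)
    (Bounded-all S e isE bound large p 0̂-above 1̂-below (toℕ p) (sym (ℕₚ.+-identityʳ (toℕ p))) (Finₚ.≤fromℕ p))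
  where
  e : Fin (suc r) → ℕ
  e i = proj₁ (proj₂ (bounded i))

  isE : ∀ i → IsE (proj₁ (S i)) (e i)
  isE i = proj₁ (proj₂ (proj₂ (bounded i)))

  bound : ∀ i → LubellBound (Free (proj₁ (S i))) (e i)
  bound i = proj₁ (bounded i) , proj₂ (proj₂ (proj₂ (bounded i)))

-- The chain of the `Q j` followed by the `P i`

++⁺ : ∀ {a ℓ} {A : Set a} {m n} (Pr : A → Set ℓ) {xs : Fin m → A} {ys : Fin n → A} →
  (∀ i → Pr (xs i)) → (∀ i → Pr (ys i)) → ∀ i → Pr ((xs ++ ys) i)
++⁺ {m = m} Pr xs∈ ys∈ i with splitAt m i
... | inj₁ j = xs∈ j
... | inj₂ j = ys∈ j

theorem6p2 : (k ℓ : ℕ) → ¬ (k ≡ 0 × ℓ ≡ 0) →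
    (P : Fin k → FinPoset) (Q : Fin ℓ → FinPoset) →
    (∀ i → LBounded (poset (P i))) → (∀ j → LBounded (poset (Q j))) →
    (I : ∀ i → Interval (poset (P i))) (I′ : ∀ j → Interval (poset (Q j))) →
    (∀ i → IsLarge (poset (P i)) (I i)) → (∀ j → IsLarge (poset (Q j)) (I′ j)) →
    (∀ i → Has-0̂ (poset (P i))) → (∀ j → Has-1̂ (poset (Q j))) →
    LBounded (⊕I ((λ j → poset (Q j) , I′ j) ++ (λ i → poset (P i) , I i)))
theorem6p2 k ℓ k,ℓ≢0 P Q P-bounded Q-bounded I I′ I-large I′-large 0̂ 1̂ =
  ⊕I-LBounded (Q′ ++ P′) (++⁺ (λ S → LBounded (proj₁ S)) Q-bounded P-bounded)
    (++⁺ (λ S → IsLarge (proj₁ S) (proj₂ S)) I′-large I-large) (fromℕ< (pivot k ℓ k,ℓ≢0)) 0̂-above 1̂-below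
  where
  P′ : Fin k → Σ Pos Interval
  P′ i = poset (P i) , I i
  Q′ : Fin ℓ → Σ Pos Interval
  Q′ j = poset (Q j) , I′ j

  -- The chain is built from the last `Q j` if there is one; otherwise `pred 0` is 0, the index of
  -- the first `P i`.
  pivot : ∀ k ℓ → ¬ (k ≡ 0 × ℓ ≡ 0) → pred ℓ < ℓ + k
  pivot k       (suc ℓ) _   = s≤s (ℕₚ.m≤m+n ℓ k)
  pivot (suc k) zero    _   = s≤s z≤n
  pivot zero    zero    ≢0 = contradiction (refl , refl) ≢0

  pred<⇒≤ : ∀ m {n} → pred m < n → m ≤ n
  pred<⇒≤ zero    _ = z≤n
  pred<⇒≤ (suc m) p = p

  toℕ-pivot = Finₚ.toℕ-fromℕ< (pivot k ℓ k,ℓ≢0)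

  0̂-above : ∀ {i} → toℕ (fromℕ< (pivot k ℓ k,ℓ≢0)) < toℕ i → Has-0̂ (proj₁ ((Q′ ++ P′) i))
  0̂-above {i} p<i = subst (λ S → Has-0̂ (proj₁ S)) (sym (lookup-++-≥ Q′ P′ i ℓ≤i)) (0̂ _)
    where
    ℓ≤i : ℓ ≤ toℕ i
    ℓ≤i = pred<⇒≤ ℓ (subst (_< toℕ i) toℕ-pivot p<i)

  1̂-below : ∀ {i} → toℕ i < toℕ (fromℕ< (pivot k ℓ k,ℓ≢0)) → Has-1̂ (proj₁ ((Q′ ++ P′) i))
  1̂-below {i} i<p = subst (λ S → Has-1̂ (proj₁ S)) (sym (lookup-++-< Q′ P′ i i<ℓ)) (1̂ _)
    where
    i<ℓ : toℕ i < ℓ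
    i<ℓ = ℕₚ.<-≤-trans (subst (toℕ i <_) toℕ-pivot i<p) (ℕₚ.pred[n]≤n {ℓ})
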